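{- Let $n,k$ be positive integers with $n \geq 2k+1$, and let $TT_n$ be the transitive (acyclic) tournament on $n$ vertices. Then \[ \mathrm{sinv}_k(TT_n) = \mathrm{sinv}'_k(TT_n) = \begin{cases} 2 & \text{if } 2k+1 \leq n < 3k,\\ 1 & \text{if } 3k \leq n. \end{cases} \]
   Context: A tournament is an orientation of a complete graph; $TT_n$ denotes the unique (up to isomorphism) acyclic tournament on $n$ vertices. For a digraph $D$ and $X \subseteq V(D)$, inverting $X$ means reversing the direction of every arc of $D$ with both endvertices in $X$. A digraph $D$ is $k$-arc-strong if for every partition $(V_1,V_2)$ of $V(D)$ into nonempty sets there are at least $k$ arcs from $V_1$ to $V_2$; it is $k$-strong if $|V(D)|\ge k+1$ and $D-S$ is strongly connected for every $S\subseteq V(D)$ with $|S|<k$. $\mathrm{sinv}'_k(D)$ (resp. $\mathrm{sinv}_k(D)$) is the minimum number of sets whose successive inversion transforms $D$ into a $k$-arc-strong (resp. $k$-strong) digraph. -}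

module Defs where

open import Data.Bool using (Bool; true; false; T; T?; _∧_; if_then_else_)
open import Data.Fin using (Fin; _<_; _<?_)
open import Data.Fin.Properties using (<-irrefl; <-trans; <-cmp)
open import Data.Fin.Subset using (Subset; _∈_; _∉_; Nonempty; ∁; ∣_∣)
open import Data.Fin.Subset.Properties using (_∈?_)
open import Data.List using (List; length; filter; cartesianProduct; allFin)
open import Data.Nat as ℕ using (ℕ; _+_; _≤_)
open import Data.Nat.Properties using (<⇒<ᵇ; <ᵇ⇒<)
open import Data.Product using (_×_; _,_; ∃)
open import Data.Sum using (_⊎_; inj₁; inj₂)
open import Data.Vec using (Vec; lookup; foldl)
open import Relation.Binary.Construct.Closure.ReflexiveTransitive using (Star)
open import Relation.Binary.Construct.Closure.Transitive using (TransClosure; [_]; _∷_)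
open import Relation.Binary.Definitions using (tri<; tri≈; tri>)
open import Relation.Binary.PropositionalEquality using (_≡_; _≢_; refl)
open import Relation.Nullary using (¬_; does; contradiction)
open import Relation.Nullary.Decidable using (_×-dec_; dec-false)

record Digraph (n : ℕ) : Set where
  field
    arc      : Fin n → Fin n → Bool
    loopless : ∀ v → arc v v ≡ false

  _⟶_ : Fin n → Fin n → Set
  u ⟶ v = T (arc u v)

open Digraph public using (arc; loopless)

module _ {n : ℕ} (D : Digraph n) where
  open Digraph D using (_⟶_)

  IsTournament : Set
  IsTournament = ∀ u v → u ≢ v → (u ⟶ v × ¬ v ⟶ u) ⊎ (v ⟶ u × ¬ u ⟶ v)

  IsAcyclic : Set
  IsAcyclic = ∀ v → ¬ TransClosure _⟶_ v v

  arcsBetween : Subset n → Subset n → List (Fin n × Fin n)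
  arcsBetween V₁ V₂ =
    filter (λ (u , v) → u ∈? V₁ ×-dec v ∈? V₂ ×-dec T? (arc D u v))
           (cartesianProduct (allFin n) (allFin n))

  IsArcStrong : ℕ → Set
  IsArcStrong k = ∀ (V₁ : Subset n) → Nonempty V₁ → Nonempty (∁ V₁) →
    k ≤ length (arcsBetween V₁ (∁ V₁))

  -- The arc relation of the subdigraph D − S induced on the vertices outside S.
  ArcAvoiding : Subset n → Fin n → Fin n → Set
  ArcAvoiding S u v = u ∉ S × v ∉ S × u ⟶ v

  StronglyConnectedWithout : Subset n → Set
  StronglyConnectedWithout S = ∀ u v → u ∉ S → v ∉ S → Star (ArcAvoiding S) u v

  IsStrong : ℕ → Set
  IsStrong k = k + 1 ≤ n × (∀ (S : Subset n) → ∣ S ∣ ℕ.< k → StronglyConnectedWithout S)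

invert : ∀ {n} → Digraph n → Subset n → Digraph n
invert D X .arc u v = if lookup X u ∧ lookup X v then arc D v u else arc D u v
invert D X .loopless v with lookup X v ∧ lookup X v
... | true  = loopless D v
... | false = loopless D v

invertAll : ∀ {n m} → Digraph n → Vec (Subset n) m → Digraph n
invertAll {n} = foldl (λ _ → Digraph n) invert

IsMinimum : (ℕ → Set) → ℕ → Set
IsMinimum P m = P m × (∀ j → P j → m ≤ j)

-- sinv k D and sinv′ k D are undefined when no family of inversions works,
-- so "sinv k D = m" is expressed as a relation.

Sinv_[_]≡_ : ∀ {n} → ℕ → Digraph n → ℕ → Set
Sinv_[_]≡_ {n} k D = IsMinimum λ m → ∃ λ (Xs : Vec (Subset n) m) → IsStrong (invertAll D Xs) k

Sinv′_[_]≡_ : ∀ {n} → ℕ → Digraph n → ℕ → Set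
Sinv′_[_]≡_ {n} k D = IsMinimum λ m → ∃ λ (Xs : Vec (Subset n) m) → IsArcStrong (invertAll D Xs) k

TT : ∀ n → Digraph n
TT n .arc u v = does (u <? v)
TT n .loopless v = dec-false (v <? v) (<-irrefl refl)

TT-isTournament : ∀ n → IsTournament (TT n)
TT-isTournament n u v u≢v with <-cmp u v
... | tri< u<v _ v≮u = inj₁ (<⇒<ᵇ u<v , λ p → v≮u (<ᵇ⇒< _ _ p))
... | tri≈ _ u≡v _   = contradiction u≡v u≢v
... | tri> u≮v _ v<u = inj₂ (<⇒<ᵇ v<u , λ p → u≮v (<ᵇ⇒< _ _ p))

TT-isAcyclic : ∀ n → IsAcyclic (TT n)
TT-isAcyclic n v p = <-irrefl refl (walk⇒< p)
  where
  walk⇒< : ∀ {u w} → TransClosure (Digraph._⟶_ (TT n)) u w → u < w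
  walk⇒< [ a ]   = <ᵇ⇒< _ _ a
  walk⇒< (a ∷ p) = <-trans (<ᵇ⇒< _ _ a) (walk⇒< p)

{-# OPTIONS --safe #-}

-- Lower bounds need only degrees. A vertex outside X keeps its neighbourhoods
-- when X is inverted in TT n, so if all in- and out-degrees become at least k,
-- then X contains the first k and the last k vertices. The out-neighbours of
-- the first vertex then lie outside X, hence among the n − 2k middle vertices,
-- and k ≤ n − 2k.
--
-- For n ≥ 3k, inverting the first k and the last k vertices together produces
-- A → B → C → A for the blocks A (first k), B (middle), C (last k); each block
-- has at least k vertices, so it survives the deletion of fewer than k vertices.
--
-- For n ≥ 2k + 1, invert the even vertices and then the odd ones: u → v holds
-- for v < u of the same parity and for v > u of the other parity. (For
-- n = 2k + 1 this is the rotational tournament.) Every vertex has at least k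
-- out-neighbours, so one of them survives a deletion of fewer than k vertices.
-- To reach a surviving v of the other parity from u: if u < v, there is an arc.
-- Otherwise take a surviving out-neighbour w of u: if it has the parity of u, then
-- w < u and we recurse; if not, then v < w have the same parity, and u → w → v.

module Submission where

open import Defs
open import Data.Bool using (true; false; T; T?)
open import Data.Bool.Properties using (∧-zeroʳ)
open import Data.Fin as Fin using (Fin; zero; suc; toℕ; fromℕ<; inject≤; punchIn)
open import Data.Fin.Properties as Fin using (toℕ<n; toℕ-fromℕ<; toℕ-injective; fromℕ<-injective; inject≤-injective; injective⇒≤; punchInᵢ≢i; punchIn-injective; any?; ¬∀⟶∃¬)
open import Data.Fin.Subset using (Subset; _∈_; _∉_; _∪_; _-_; ⊥; ∁; ⁅_⁆; ∣_∣; Nonempty; inside; outside)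
open import Data.Fin.Subset.Properties using (_∈?_; ∉⊥; ∣⊥∣≡0; x∈⁅x⁆; x∈⁅y⁆⇒x≡y; x≢y⇒x∉⁅y⁆; x∈p∪q⁺; x∈p∪q⁻; ∪-identityˡ; x∈∁p⇒x∉p; x∉p⇒x∈∁p; x∉∁p⇒x∈p; x∈p⇒x∉∁p; x∈p∧x≢y⇒x∈p-y; x∈p⇒∣p-x∣<∣p∣)
open import Data.List as List using (List; []; _∷_; length; cartesianProduct; allFin)
open import Data.List.Membership.Propositional as List using ()
open import Data.List.Membership.Propositional.Properties using (∈-filter⁺; ∈-filter⁻; ∈-cartesianProduct⁺; ∈-allFin; ∈-lookup)
open import Data.List.Relation.Unary.All as All using ()
open import Data.List.Relation.Unary.AllPairs using (_∷_)
open import Data.List.Relation.Unary.Any using (here; there; index)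
open import Data.List.Relation.Unary.Any.Properties using (lookup-index)
open import Data.List.Relation.Unary.Unique.Propositional using (Unique)
open import Data.List.Relation.Unary.Unique.Propositional.Properties using (cartesianProduct⁺; allFin⁺; filter⁺)
open import Data.Nat using (ℕ; zero; suc; _+_; _*_; _∸_; _≤_; _<_; z≤n; s≤s; s≤s⁻¹; parity; _≤?_; _<?_)
open import Data.Nat.Induction using (Acc; acc; <-wellFounded)
open import Data.Nat.Properties
open import Data.Parity.Base using (Parity; 0ℙ; 1ℙ)
open import Data.Parity.Properties as ℙ using (suc-homo-⁻¹; p≢p⁻¹)
open import Data.Product using (_×_; _,_; ∃; ∃₂; proj₁; proj₂)
open import Data.Sum using (_⊎_; inj₁; inj₂; [_,_]′)
open import Data.Vec as Vec using (Vec; []; _∷_; lookup)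
open import Data.Vec.Properties using (lookup∘tabulate; lookup⇒[]=; []=⇒lookup)
open import Function using (_∘_; case_of_)
open import Function.Definitions using (Injective)
open import Relation.Binary.Construct.Closure.ReflexiveTransitive using (Star; ε; _◅_; _◅◅_)
open import Relation.Binary.Definitions using (tri<; tri≈; tri>)
open import Relation.Binary.PropositionalEquality using (_≡_; _≢_; refl; sym; trans; cong; cong₂; subst)
open import Relation.Nullary using (¬_; yes; no; does; contradiction)
open import Relation.Nullary.Decidable using (_×-dec_; _⊎-dec_; ¬?; dec-true; decidable-stable)
open import Relation.Unary using (Decidable)

private
  variable
    k m n : ℕ

-- Finite sets

injective-into⇒≤∣∣ : {S : Subset n} (f : Fin k → Fin n) → Injective _≡_ _≡_ f →
                     (∀ i → f i ∈ S) → k ≤ ∣ S ∣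
injective-into⇒≤∣∣ {k = zero}  f f-inj f∈S = z≤n
injective-into⇒≤∣∣ {k = suc k} {S} f f-inj f∈S = <-≤-trans
  (s≤s (injective-into⇒≤∣∣ {S = S - f zero} (f ∘ suc) (Fin.suc-injective ∘ f-inj)
    (λ i → x∈p∧x≢y⇒x∈p-y (f∈S (suc i)) (λ eq → case f-inj {suc i} {zero} eq of λ ()))))
  (x∈p⇒∣p-x∣<∣p∣ (f∈S zero))

injective-into-interval⇒≤ : ∀ {a b} (f : Fin k → Fin n) → Injective _≡_ _≡_ f →
                            (∀ i → a ≤ toℕ (f i)) → (∀ i → toℕ (f i) < b) → k ≤ b ∸ a
injective-into-interval⇒≤ {a = a} f f-inj a≤f f<b =
  injective⇒≤ {f = λ i → fromℕ< (∸-monoˡ-< (f<b i) (a≤f i))}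
    (λ {i} {j} eq → f-inj (toℕ-injective
      (∸-cancelʳ-≡ (a≤f i) (a≤f j) (fromℕ<-injective _ _ _ _ eq))))

-- Pigeonhole: `g` names `k` distinct vertices, more than `S` contains. The index `i` is returned as
-- well, so that the form of `g i` stays available.
increasing-escapes : (S : Subset n) → ∣ S ∣ < k → (g : ℕ → ℕ) →
                     (∀ {i} → i < k → g i < n) → (∀ {i j} → i < j → g i < g j) →
                     ∃₂ λ i v → i < k × toℕ v ≡ g i × v ∉ S
increasing-escapes {n} {k} S S<k g g<n g-mono
  with ¬∀⟶∃¬ k (λ i → f i ∈ S) (λ i → f i ∈? S)
             (λ f∈S → ≤⇒≯ (injective-into⇒≤∣∣ f f-inj f∈S) S<k)
  where
  f : Fin k → Fin n
  f i = fromℕ< (g<n (toℕ<n i))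

  f-inj : Injective _≡_ _≡_ f
  f-inj {i} {j} eq with <-cmp (toℕ i) (toℕ j)
  ... | tri≈ _ i≡j _ = toℕ-injective i≡j
  ... | tri< i<j _ _ = contradiction (fromℕ<-injective _ _ _ _ eq) (<⇒≢ (g-mono i<j))
  ... | tri> _ _ j<i = contradiction (fromℕ<-injective _ _ _ _ eq) (>⇒≢ (g-mono j<i))
... | i , fi∉S = toℕ i , _ , toℕ<n i , toℕ-fromℕ< _ , fi∉S

∣⁅x⁆∪p∣≤1+∣p∣ : (x : Fin n) (p : Subset n) → ∣ ⁅ x ⁆ ∪ p ∣ ≤ suc ∣ p ∣
∣⁅x⁆∪p∣≤1+∣p∣ zero    (inside  ∷ p) rewrite ∪-identityˡ p = n≤1+n _
∣⁅x⁆∪p∣≤1+∣p∣ zero    (outside ∷ p) rewrite ∪-identityˡ p = ≤-refl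
∣⁅x⁆∪p∣≤1+∣p∣ (suc x) (inside  ∷ p) = s≤s (∣⁅x⁆∪p∣≤1+∣p∣ x p)
∣⁅x⁆∪p∣≤1+∣p∣ (suc x) (outside ∷ p) = ∣⁅x⁆∪p∣≤1+∣p∣ x p

module _ {A : Set} (h : A → Fin n) where

  image : List A → Subset n
  image []       = ⊥
  image (x ∷ xs) = ⁅ h x ⁆ ∪ image xs

  ∣image∣≤length : ∀ xs → ∣ image xs ∣ ≤ length xs
  ∣image∣≤length []       = ≤-reflexive (∣⊥∣≡0 n)
  ∣image∣≤length (x ∷ xs) = ≤-trans (∣⁅x⁆∪p∣≤1+∣p∣ (h x) _) (s≤s (∣image∣≤length xs))

  ∈-image⁺ : ∀ {x xs} → x List.∈ xs → h x ∈ image xs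
  ∈-image⁺ (here refl) = x∈p∪q⁺ (inj₁ (x∈⁅x⁆ _))
  ∈-image⁺ (there x∈)  = x∈p∪q⁺ (inj₂ (∈-image⁺ x∈))

  ∈-image⁻ : ∀ {v} xs → v ∈ image xs → ∃ λ x → x List.∈ xs × v ≡ h x
  ∈-image⁻ []       v∈ = contradiction v∈ ∉⊥
  ∈-image⁻ (x ∷ xs) v∈ with x∈p∪q⁻ ⁅ h x ⁆ (image xs) v∈
  ... | inj₁ v∈hx = x , here refl , x∈⁅y⁆⇒x≡y _ v∈hx
  ... | inj₂ v∈xs with ∈-image⁻ xs v∈xs
  ...   | y , y∈ , eq = y , there y∈ , eq

module _ {P : Fin n → Set} (P? : Decidable P) where

  select : Subset n
  select = Vec.tabulate (does ∘ P?)

  ∈-select⁺ : ∀ {v} → P v → v ∈ select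
  ∈-select⁺ {v} Pv = lookup⇒[]= v select (trans (lookup∘tabulate _ v) (dec-true (P? v) Pv))

  ∈-select⁻ : ∀ {v} → v ∈ select → P v
  ∈-select⁻ {v} v∈ with P? v | trans (sym (lookup∘tabulate (does ∘ P?) v)) ([]=⇒lookup v∈)
  ... | yes Pv | _ = Pv

Unique-lookup-injective : {A : Set} {xs : List A} → Unique xs →
                          Injective _≡_ _≡_ (List.lookup xs)
Unique-lookup-injective {xs = x ∷ xs} (x∉ ∷ u) {zero}  {zero}  eq = refl
Unique-lookup-injective {xs = x ∷ xs} (x∉ ∷ u) {zero}  {suc j} eq =
  contradiction eq (All.lookup x∉ (∈-lookup j))
Unique-lookup-injective {xs = x ∷ xs} (x∉ ∷ u) {suc i} {zero}  eq =
  contradiction (sym eq) (All.lookup x∉ (∈-lookup i))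
Unique-lookup-injective {xs = x ∷ xs} (x∉ ∷ u) {suc i} {suc j} eq =
  cong suc (Unique-lookup-injective u eq)

∈-injective⇒≤length : {A : Set} {xs : List A} (g : Fin k → A) → Injective _≡_ _≡_ g →
                      (∀ i → g i List.∈ xs) → k ≤ length xs
∈-injective⇒≤length {xs = xs} g g-inj g∈ = injective⇒≤ {f = λ i → index (g∈ i)}
  (λ {i} {j} eq → g-inj (trans (lookup-index (g∈ i))
    (trans (cong (List.lookup xs) eq) (sym (lookup-index (g∈ j))))))

-- Cuts and degrees

module _ (D : Digraph n) where
  open Digraph D using (_⟶_)

  Crosses : Subset n → Fin n × Fin n → Set
  Crosses V (u , v) = u ∈ V × v ∈ ∁ V × u ⟶ v

  crosses? : ∀ V → Decidable (Crosses V)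
  crosses? V (u , v) = u ∈? V ×-dec v ∈? ∁ V ×-dec T? (arc D u v)

  cut : Subset n → List (Fin n × Fin n)
  cut V = arcsBetween D V (∁ V)

  ∈-cut⁺ : ∀ {V u v} → Crosses V (u , v) → (u , v) List.∈ cut V
  ∈-cut⁺ {V} = ∈-filter⁺ (crosses? V) (∈-cartesianProduct⁺ (∈-allFin _) (∈-allFin _))

  ∈-cut⁻ : ∀ {V e} → e List.∈ cut V → Crosses V e
  ∈-cut⁻ {V} e∈ = proj₂ (∈-filter⁻ (crosses? V) {xs = cartesianProduct (allFin n) (allFin n)} e∈)

  cut-unique : ∀ V → Unique (cut V)
  cut-unique V = filter⁺ (crosses? V) (cartesianProduct⁺ (allFin⁺ n) (allFin⁺ n))

  -- The cut is listed without repetition, so its first `k` entries are distinct arcs. An injective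
  -- family is the form in which neighbours get counted later.
  arcStrong⇒crossing : IsArcStrong D k → ∀ {V} → Nonempty V → Nonempty (∁ V) →
    ∃ λ (e : Fin k → Fin n × Fin n) → Injective _≡_ _≡_ e × (∀ i → Crosses V (e i))
  arcStrong⇒crossing strong {V} V≢∅ ∁V≢∅ =
      (λ i → List.lookup (cut V) (inject≤ i k≤))
    , (λ eq → inject≤-injective k≤ k≤ _ _ (Unique-lookup-injective (cut-unique V) eq))
    , (λ i → ∈-cut⁻ (∈-lookup (inject≤ i k≤)))
    where k≤ = strong V V≢∅ ∁V≢∅

  path-crosses : ∀ {S V u v} → Star (ArcAvoiding D S) u v → u ∈ V → v ∈ ∁ V →
                 ∃ λ e → Crosses V e × proj₁ e ∉ S × proj₂ e ∉ S
  path-crosses ε u∈V u∈∁V = contradiction u∈V (x∈∁p⇒x∉p u∈∁V)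
  path-crosses {V = V} (_◅_ {j = w} (u∉S , w∉S , u⟶w) p) u∈V v∈∁V with w ∈? V
  ... | yes w∈V = path-crosses p w∈V v∈∁V
  ... | no  w∉V = _ , (u∈V , x∉p⇒x∈∁p w∉V , u⟶w) , u∉S , w∉S

  -- Deleting one endpoint of every crossing arc, chosen different from u and v,
  -- would separate u from v.
  strong⇒k≤cut : IsStrong D k → ∀ {V u v} → u ∈ V → v ∈ ∁ V → ¬ u ⟶ v → k ≤ length (cut V)
  strong⇒k≤cut (_ , connected) {V} {u} {v} u∈V v∈∁V u↛v = ≮⇒≥ λ cut<k →
    let S    = image end (cut V)
        p    = connected S (≤-<-trans (∣image∣≤length end (cut V)) cut<k) u v u∉S v∉S
        (a , b) , crosses , a∉S , b∉S = path-crosses p u∈V v∈∁V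
    in [ (λ eq → a∉S (subst (_∈ S) eq (∈-image⁺ end (∈-cut⁺ crosses))))
       , (λ eq → b∉S (subst (_∈ S) eq (∈-image⁺ end (∈-cut⁺ crosses)))) ]′ (end-is-end a b)
    where
    end : Fin n × Fin n → Fin n
    -- The tail of a crossing arc lies in `V`, so it is not `v`. Only a tail equal to `u` forces the
    -- head, and that head is not `v` because `u` has no arc to `v`.
    end (a , b) with a Fin.≟ u
    ... | yes _ = b
    ... | no  _ = a

    end-is-end : ∀ a b → end (a , b) ≡ a ⊎ end (a , b) ≡ b
    end-is-end a b with a Fin.≟ u
    ... | yes _ = inj₂ refl
    ... | no  _ = inj₁ refl

    u≢end : ∀ {e} → Crosses V e → u ≢ end e
    u≢end {a , b} (a∈V , b∈∁V , _) u≡ with a Fin.≟ u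
    ... | yes _   = x∈∁p⇒x∉p b∈∁V (subst (_∈ V) u≡ u∈V)
    ... | no  a≢u = a≢u (sym u≡)

    v≢end : ∀ {e} → Crosses V e → v ≢ end e
    v≢end {a , b} (a∈V , b∈∁V , a⟶b) v≡ with a Fin.≟ u
    ... | yes refl = u↛v (subst (u ⟶_) (sym v≡) a⟶b)
    ... | no  _    = x∈∁p⇒x∉p v∈∁V (subst (_∈ V) (sym v≡) a∈V)

    u∉S : u ∉ image end (cut V)
    u∉S u∈ with ∈-image⁻ end (cut V) u∈
    ... | e , e∈ , u≡ = u≢end (∈-cut⁻ e∈) u≡

    v∉S : v ∉ image end (cut V)
    v∉S v∈ with ∈-image⁻ end (cut V) v∈
    ... | e , e∈ , v≡ = v≢end (∈-cut⁻ e∈) v≡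

-- The n arcs joining u to ∁ V and V \ u to v are distinct.
complete-cut : (D : Digraph (suc n)) → ∀ {V u v} → u ∈ V → v ∈ ∁ V →
               (∀ {a b} → a ∈ V → b ∈ ∁ V → T (arc D a b)) → n ≤ length (cut D V)
complete-cut D {V} {u} {v} u∈V v∈∁V complete =
  -- `punchIn u` leaves out `u`, since `star` sends both `u` and `v` to the arc from `u` to `v`.
  ∈-injective⇒≤length (star ∘ punchIn u)
    (λ eq → punchIn-injective u _ _ (star-injective (punchInᵢ≢i u _) (punchInᵢ≢i u _) eq))
    (λ i → ∈-cut⁺ D (star-crosses (punchIn u i)))
  where
  star : Fin _ → Fin _ × Fin _
  star w with w ∈? V
  ... | yes _ = w , v
  ... | no  _ = u , w

  star-crosses : ∀ w → Crosses D V (star w)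
  star-crosses w with w ∈? V
  ... | yes w∈V = w∈V , v∈∁V , complete w∈V v∈∁V
  ... | no  w∉V = u∈V , x∉p⇒x∈∁p w∉V , complete u∈V (x∉p⇒x∈∁p w∉V)

  star-injective : ∀ {w w′} → w ≢ u → w′ ≢ u → star w ≡ star w′ → w ≡ w′
  star-injective {w} {w′} w≢u w′≢u eq with w ∈? V | w′ ∈? V
  ... | yes _ | yes _ = cong proj₁ eq
  ... | yes _ | no  _ = contradiction (cong proj₁ eq) w≢u
  ... | no  _ | yes _ = contradiction (sym (cong proj₁ eq)) w′≢u
  ... | no  _ | no  _ = cong proj₂ eq

-- If some arc from `V` to `∁ V` is missing, its ends satisfy the hypotheses of `strong⇒k≤cut`.
-- Otherwise the cut is complete and `k + 1 ≤ n` suffices.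
strong⇒arcStrong : (D : Digraph n) → IsStrong D k → IsArcStrong D k
strong⇒arcStrong {suc n} {k} D strong@(k+1≤n , _) V (u , u∈V) (v , v∈∁V)
  with any? (λ a → any? (λ b → a ∈? V ×-dec b ∈? ∁ V ×-dec ¬? (T? (arc D a b))))
... | yes (a , b , a∈V , b∈∁V , a↛b) = strong⇒k≤cut D strong a∈V b∈∁V a↛b
... | no ¬missing = ≤-trans (s≤s⁻¹ (subst (_≤ suc n) (+-comm k 1) k+1≤n))
  (complete-cut D u∈V v∈∁V λ a∈V b∈∁V →
    decidable-stable (T? _) (λ a↛b → ¬missing (_ , _ , a∈V , b∈∁V , a↛b)))

module _ (D : Digraph (suc (suc n))) (strong : IsArcStrong D k) where

  -- All arcs leaving `⁅ v ⁆` share the tail `v`, so distinct arcs have distinct heads. With at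
  -- least two vertices the complement is nonempty, as `punchIn v zero` shows.
  arcStrong⇒out-neighbours : ∀ v → ∃ λ (w : Fin k → Fin _) →
    Injective _≡_ _≡_ w × (∀ i → T (arc D v (w i)))
  arcStrong⇒out-neighbours v
    with arcStrong⇒crossing D strong {⁅ v ⁆} (v , x∈⁅x⁆ v)
           (punchIn v zero , x∉p⇒x∈∁p (x≢y⇒x∉⁅y⁆ (punchInᵢ≢i v zero)))
  ... | e , e-inj , crosses =
      proj₂ ∘ e
    , (λ {i} {j} eq → e-inj (cong₂ _,_ (trans (source i) (sym (source j))) eq))
    , (λ i → subst (λ u → T (arc D u (proj₂ (e i)))) (source i) (proj₂ (proj₂ (crosses i))))
    where
    source : ∀ i → proj₁ (e i) ≡ v
    source i = x∈⁅y⁆⇒x≡y v (proj₁ (crosses i))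

  arcStrong⇒in-neighbours : ∀ v → ∃ λ (w : Fin k → Fin _) →
    Injective _≡_ _≡_ w × (∀ i → T (arc D (w i) v))
  arcStrong⇒in-neighbours v
    with arcStrong⇒crossing D strong {∁ ⁅ v ⁆}
           (punchIn v zero , x∉p⇒x∈∁p (x≢y⇒x∉⁅y⁆ (punchInᵢ≢i v zero)))
           (v , x∉p⇒x∈∁p (x∈p⇒x∉∁p (x∈⁅x⁆ v)))
  ... | e , e-inj , crosses =
      proj₁ ∘ e
    , (λ {i} {j} eq → e-inj (cong₂ _,_ eq (trans (target i) (sym (target j)))))
    , (λ i → subst (λ u → T (arc D (proj₁ (e i)) u)) (target i) (proj₂ (proj₂ (crosses i))))
    where
    target : ∀ i → proj₂ (e i) ≡ v
    target i = x∈⁅y⁆⇒x≡y v (x∉∁p⇒x∈p (x∈∁p⇒x∉p (proj₁ (proj₂ (crosses i)))))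

-- Inversions of the transitive tournament

∉⇒lookup≡false : ∀ (X : Subset n) {v} → v ∉ X → lookup X v ≡ false
∉⇒lookup≡false X {v} v∉X with lookup X v in eq
... | false = refl
... | true  = contradiction (lookup⇒[]= v X eq) v∉X

module _ (D : Digraph n) (X : Subset n) {u v : Fin n} where

  invert-∈ : u ∈ X → v ∈ X → arc (invert D X) u v ≡ arc D v u
  invert-∈ u∈X v∈X rewrite []=⇒lookup u∈X | []=⇒lookup v∈X = refl

  invert-∉ˡ : u ∉ X → arc (invert D X) u v ≡ arc D u v
  invert-∉ˡ u∉X rewrite ∉⇒lookup≡false X u∉X = refl

  invert-∉ʳ : v ∉ X → arc (invert D X) u v ≡ arc D u v
  invert-∉ʳ v∉X rewrite ∉⇒lookup≡false X v∉X | ∧-zeroʳ (lookup X u) = refl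

TT-arc⁺ : ∀ {u v : Fin n} → toℕ u < toℕ v → T (arc (TT n) u v)
TT-arc⁺ = <⇒<ᵇ

TT-arc⁻ : ∀ {u v : Fin n} → T (arc (TT n) u v) → toℕ u < toℕ v
TT-arc⁻ = <ᵇ⇒< _ _

TT-notArcStrong : 2 ≤ n → 1 ≤ k → ¬ IsArcStrong (TT n) k
TT-notArcStrong {suc (suc n)} (s≤s (s≤s _)) 1≤k strong
  with arcStrong⇒in-neighbours (TT _) strong zero
... | w , w-inj , w⟶0 = n≮0
  -- The in-neighbours of `zero` would have to lie in an empty interval.
  (≤-trans 1≤k (injective-into-interval⇒≤ {a = 0} {b = 0} w w-inj (λ _ → z≤n) (TT-arc⁻ ∘ w⟶0)))

module _ (X : Subset (suc (suc n))) (strong : IsArcStrong (invert (TT _) X) k) where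

  -- The in-neighbours of `v` are still the vertices before it, and there are `toℕ v` of these.
  ∉⇒k≤ : ∀ {v} → v ∉ X → k ≤ toℕ v
  ∉⇒k≤ {v} v∉X with arcStrong⇒in-neighbours (invert (TT _) X) strong v
  ... | w , w-inj , w⟶v = injective-into-interval⇒≤ {a = 0} w w-inj (λ _ → z≤n)
    (λ i → TT-arc⁻ (subst T (invert-∉ʳ (TT _) X v∉X) (w⟶v i)))

  -- Dually, the `k` out-neighbours come after `v`. The bound is written as a difference to serve as
  -- the upper end of an interval in `invert-TT-bound`.
  ∉⇒<n∸k : ∀ {v} → v ∉ X → toℕ v < suc (suc n) ∸ k
  ∉⇒<n∸k {v} v∉X with arcStrong⇒out-neighbours (invert (TT _) X) strong v
  ... | w , w-inj , v⟶w = m+n≤o⇒m≤o∸n (suc (toℕ v)) (subst (_≤ suc (suc n)) (+-comm k (suc (toℕ v)))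
    (m≤o∸n⇒m+n≤o k (toℕ<n v) (injective-into-interval⇒≤ w w-inj
      (λ i → TT-arc⁻ (subst T (invert-∉ˡ (TT _) X v∉X) (v⟶w i))) (toℕ<n ∘ w))))

  invert-TT-bound : 1 ≤ k → 2 * k ≤ suc (suc n) → 3 * k ≤ suc (suc n)
  invert-TT-bound 1≤k 2k≤n with arcStrong⇒out-neighbours (invert (TT _) X) strong zero
  -- Subtraction is truncated, so `2k≤n` is what allows `2 * k` to change sides; `k + 2 * k` is
  -- `3 * k` by computation.
  ... | w , w-inj , 0⟶w = m≤o∸n⇒m+n≤o k 2k≤n k≤n∸2k
    where
    0∈X : zero ∈ X
    0∈X = decidable-stable (zero ∈? X) (λ 0∉X → n≮0 (≤-trans 1≤k (∉⇒k≤ 0∉X)))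

    w∉X : ∀ i → w i ∉ X
    -- If `w i` were in `X` too, its arc from `zero` would be a reversed one, and `w i` would
    -- precede `zero`.
    w∉X i wi∈X = n≮0 (TT-arc⁻ {u = w i} {v = zero} (subst T (invert-∈ (TT _) X 0∈X wi∈X) (0⟶w i)))

    k≤n∸2k : k ≤ suc (suc n) ∸ 2 * k
    k≤n∸2k = subst (k ≤_)
      (trans (∸-+-assoc (suc (suc n)) k k) (cong (λ x → suc (suc n) ∸ (k + x)) (sym (+-identityʳ k))))
      (injective-into-interval⇒≤ w w-inj (∉⇒k≤ ∘ w∉X) (∉⇒<n∸k ∘ w∉X))

-- One inversion, for 3k ≤ n

module ThreeBlocks n k (3k≤n : 3 * k ≤ n) where

  InA InB InC : Fin n → Set
  InA v = toℕ v < k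
  InB v = k ≤ toℕ v × toℕ v + k < n
  InC v = n ≤ toℕ v + k

  outer? : Decidable (λ v → InA v ⊎ InC v)
  outer? v = (toℕ v <? k) ⊎-dec (n ≤? toℕ v + k)

  X : Subset n
  X = select outer?

  D : Digraph n
  D = invert (TT n) X

  block : ∀ v → InA v ⊎ InB v ⊎ InC v
  block v with toℕ v <? k | n ≤? toℕ v + k
  ... | yes v<k | _       = inj₁ v<k
  ... | no  v≮k | no  n≰  = inj₂ (inj₁ (≮⇒≥ v≮k , ≰⇒> n≰))
  ... | no  _   | yes n≤  = inj₂ (inj₂ n≤)

  InB⇒∉X : ∀ {v} → InB v → v ∉ X
  InB⇒∉X (k≤v , v+k<n) v∈X with ∈-select⁻ outer? v∈X
  ... | inj₁ v<k   = ≤⇒≯ k≤v v<k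
  ... | inj₂ n≤v+k = ≤⇒≯ n≤v+k v+k<n

  A⟶B : ∀ {u v} → InA u → InB v → T (arc D u v)
  A⟶B u<k v∈B@(k≤v , _) =
    subst T (sym (invert-∉ʳ (TT n) X (InB⇒∉X v∈B))) (TT-arc⁺ (<-≤-trans u<k k≤v))

  B⟶C : ∀ {u v} → InB u → InC v → T (arc D u v)
  B⟶C u∈B@(_ , u+k<n) n≤v+k = subst T (sym (invert-∉ˡ (TT n) X (InB⇒∉X u∈B)))
    (TT-arc⁺ (+-cancelʳ-< k _ _ (<-≤-trans u+k<n n≤v+k)))

  2k≤n : k + k ≤ n
  2k≤n = ≤-trans (+-monoʳ-≤ k (m≤m+n k (k + 0))) 3k≤n

  -- Both ends lie in `X`, so the arc is reversed; `2k≤n` places every vertex of C after those of A.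
  C⟶A : ∀ {u v} → InC u → InA v → T (arc D u v)
  C⟶A n≤u+k v<k =
    subst T (sym (invert-∈ (TT n) X (∈-select⁺ outer? (inj₂ n≤u+k)) (∈-select⁺ outer? (inj₁ v<k))))
      (TT-arc⁺ (<-≤-trans v<k (+-cancelʳ-≤ k _ _ (≤-trans 2k≤n n≤u+k))))

  module _ (S : Subset n) (∣S∣<k : ∣ S ∣ < k) where

    survivor : ∀ o → o + k ≤ n → ∃ λ v → v ∉ S × o ≤ toℕ v × toℕ v < o + k
    survivor o o+k≤n
      with increasing-escapes S ∣S∣<k (o +_) (λ i<k → <-≤-trans (+-monoʳ-< o i<k) o+k≤n) (+-monoʳ-< o)
    ... | i , v , i<k , v≡ , v∉S =
      v , v∉S , ≤-trans (m≤m+n o i) (≤-reflexive (sym v≡))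
        , ≤-<-trans (≤-reflexive v≡) (+-monoʳ-< o i<k)

    connected : StronglyConnectedWithout D S
    connected u v u∉S v∉S
      -- The windows of length `k` starting at `0`, `k` and `n ∸ k` lie in A, B and C; the middle
      -- one ends before `2k`, and `3k≤n` keeps it clear of C.
      with survivor 0 (m+n≤o⇒m≤o k 2k≤n) | survivor k 2k≤n
         | survivor (n ∸ k) (≤-reflexive (m∸n+n≡m (m+n≤o⇒m≤o k 2k≤n)))
    ... | a , a∉S , _ , a∈A | b , b∉S , k≤b , b<2k | c , c∉S , n∸k≤c , _ =
      (to-a (block u)) ◅◅ from-a (block v)
      where
      b∈B : InB b
      b∈B = k≤b , <-≤-trans (+-monoˡ-< k b<2k)
        (≤-trans (≤-reflexive (trans (+-assoc k k k) (cong (λ x → k + (k + x)) (sym (+-identityʳ k))))) 3k≤n)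

      c∈C : InC c
      c∈C = ≤-trans (≤-reflexive (sym (m∸n+n≡m (m+n≤o⇒m≤o k 2k≤n)))) (+-monoˡ-≤ k n∸k≤c)

      _⟶*_ : Fin n → Fin n → Set
      _⟶*_ = Star (ArcAvoiding D S)

      a⟶*c : a ⟶* c
      a⟶*c = (a∉S , b∉S , A⟶B a∈A b∈B) ◅ (b∉S , c∉S , B⟶C b∈B c∈C) ◅ ε

      c⟶*a : c ⟶* a
      c⟶*a = (c∉S , a∉S , C⟶A c∈C a∈A) ◅ ε

      to-a : InA u ⊎ InB u ⊎ InC u → u ⟶* a
      to-a (inj₁ u∈A)        = (u∉S , b∉S , A⟶B u∈A b∈B) ◅ (b∉S , c∉S , B⟶C b∈B c∈C) ◅ c⟶*a
      to-a (inj₂ (inj₁ u∈B)) = (u∉S , c∉S , B⟶C u∈B c∈C) ◅ c⟶*a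
      to-a (inj₂ (inj₂ u∈C)) = (u∉S , a∉S , C⟶A u∈C a∈A) ◅ ε

      from-a : InA v ⊎ InB v ⊎ InC v → a ⟶* v
      from-a (inj₁ v∈A)        = a⟶*c ◅◅ (c∉S , v∉S , C⟶A c∈C v∈A) ◅ ε
      from-a (inj₂ (inj₁ v∈B)) = (a∉S , v∉S , A⟶B a∈A v∈B) ◅ ε
      from-a (inj₂ (inj₂ v∈C)) = (a∉S , b∉S , A⟶B a∈A b∈B) ◅ (b∉S , v∉S , B⟶C b∈B v∈C) ◅ ε

  strong : 1 ≤ k → IsStrong D k
  strong 1≤k = ≤-trans (+-monoʳ-≤ k 1≤k) 2k≤n , connected

-- Two inversions, for 2k + 1 ≤ n

nthOfParity : Parity → ℕ → ℕ
nthOfParity 0ℙ zero    = 0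
nthOfParity 1ℙ zero    = 1
nthOfParity p  (suc i) = suc (suc (nthOfParity p i))

parity-nthOfParity : ∀ p i → parity (nthOfParity p i) ≡ p
parity-nthOfParity 0ℙ zero    = refl
parity-nthOfParity 1ℙ zero    = refl
parity-nthOfParity 0ℙ (suc i) = parity-nthOfParity 0ℙ i
parity-nthOfParity 1ℙ (suc i) = parity-nthOfParity 1ℙ i

-- Consecutive terms differ by two, so a term raised by one stays below all later terms. This is the
-- room that the shift in `f` needs.
nthOfParity-gap : ∀ p {i j} → i < j → suc (nthOfParity p i) < nthOfParity p j
nthOfParity-gap 0ℙ {zero}  {suc j} _         = s≤s (s≤s z≤n)
nthOfParity-gap 1ℙ {zero}  {suc zero}    _   = ≤-refl
nthOfParity-gap 1ℙ {zero}  {suc (suc j)} _   = s≤s (s≤s (s≤s z≤n))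
nthOfParity-gap 0ℙ {suc i} {suc j} (s≤s i<j) = s≤s (s≤s (nthOfParity-gap 0ℙ i<j))
nthOfParity-gap 1ℙ {suc i} {suc j} (s≤s i<j) = s≤s (s≤s (nthOfParity-gap 1ℙ i<j))

nthOfParity≤ : ∀ p i → nthOfParity p i ≤ i * 2 + 1
nthOfParity≤ 0ℙ zero    = z≤n
nthOfParity≤ 1ℙ zero    = ≤-refl
nthOfParity≤ 0ℙ (suc i) = s≤s (s≤s (nthOfParity≤ 0ℙ i))
nthOfParity≤ 1ℙ (suc i) = s≤s (s≤s (nthOfParity≤ 1ℙ i))

parity-suc : ∀ m → parity m ≢ parity (suc m)
parity-suc m eq = p≢p⁻¹ (parity (suc m)) (trans (sym eq) (sym (suc-homo-⁻¹ m)))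

≢-≢⇒≡ : ∀ {p q r : Parity} → p ≢ q → p ≢ r → q ≡ r
≢-≢⇒≡ {0ℙ} {0ℙ}      p≢q _   = contradiction refl p≢q
≢-≢⇒≡ {0ℙ} {1ℙ} {0ℙ} _   p≢r = contradiction refl p≢r
≢-≢⇒≡ {0ℙ} {1ℙ} {1ℙ} _   _   = refl
≢-≢⇒≡ {1ℙ} {1ℙ}      p≢q _   = contradiction refl p≢q
≢-≢⇒≡ {1ℙ} {0ℙ} {1ℙ} _   p≢r = contradiction refl p≢r
≢-≢⇒≡ {1ℙ} {0ℙ} {0ℙ} _   _   = refl

module Alternating n k (2k+1≤n : 2 * k + 1 ≤ n) where

  par : Fin n → Parity
  par = parity ∘ toℕ

  class? : ∀ p → Decidable (λ v → par v ≡ p)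
  class? p v = par v ℙ.≟ p

  Class : Parity → Subset n
  Class p = select (class? p)

  ∉-Class : ∀ {p v} → par v ≢ p → v ∉ Class p
  ∉-Class v≢p = v≢p ∘ ∈-select⁻ (class? _)

  ∈-Class : ∀ {p v} → par v ≡ p → v ∈ Class p
  ∈-Class = ∈-select⁺ (class? _)

  E D : Digraph n
  E = invert (TT n) (Class 0ℙ)
  D = invert E (Class 1ℙ)

  data _↝_ (u v : Fin n) : Set where
    same  : par u ≡ par v → toℕ v < toℕ u → u ↝ v
    other : par u ≢ par v → toℕ u < toℕ v → u ↝ v

  -- The two classes are disjoint, so a pair of equal parity is reversed by exactly one of the
  -- inversions and a pair of different parity by neither.
  ↝⇒arc : ∀ {u v} → u ↝ v → T (arc D u v)
  ↝⇒arc {u} {v} (same eq v<u) with par u in pu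
  ... | 0ℙ = subst T (sym (trans
    (invert-∉ˡ E (Class 1ℙ) (∉-Class (λ e → case trans (sym pu) e of λ ())))
    (invert-∈ (TT n) (Class 0ℙ) (∈-Class pu) (∈-Class (sym eq))))) (TT-arc⁺ v<u)
  ... | 1ℙ = subst T (sym (trans
    (invert-∈ E (Class 1ℙ) (∈-Class pu) (∈-Class (sym eq)))
    (invert-∉ʳ (TT n) (Class 0ℙ) (∉-Class (λ e → case trans (sym pu) e of λ ()))))) (TT-arc⁺ v<u)
  ↝⇒arc {u} {v} (other neq u<v) with par u in pu
  ... | 0ℙ = subst T (sym (trans
    (invert-∉ˡ E (Class 1ℙ) (∉-Class (λ e → case trans (sym pu) e of λ ())))
    (invert-∉ʳ (TT n) (Class 0ℙ) (∉-Class (neq ∘ sym))))) (TT-arc⁺ u<v)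
  ... | 1ℙ = subst T (sym (trans
    (invert-∉ʳ E (Class 1ℙ) (∉-Class (neq ∘ sym)))
    (invert-∉ˡ (TT n) (Class 0ℙ) (∉-Class (λ e → case trans (sym pu) e of λ ()))))) (TT-arc⁺ u<v)

  module OutNeighbours (u : Fin n) where

    -- Shifting the numbers from u onwards by one switches them to the other parity.
    f : ℕ → ℕ
    f i with nthOfParity (par u) i <? toℕ u
    ... | yes _ = nthOfParity (par u) i
    ... | no  _ = suc (nthOfParity (par u) i)

    nthOfParity≤f : ∀ i → nthOfParity (par u) i ≤ f i
    nthOfParity≤f i with nthOfParity (par u) i <? toℕ u
    ... | yes _ = ≤-refl
    ... | no  _ = n≤1+n _

    f≤1+nthOfParity : ∀ i → f i ≤ suc (nthOfParity (par u) i)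
    f≤1+nthOfParity i with nthOfParity (par u) i <? toℕ u
    ... | yes _ = n≤1+n _
    ... | no  _ = ≤-refl

    f-mono : ∀ {i j} → i < j → f i < f j
    f-mono i<j = ≤-<-trans (f≤1+nthOfParity _) (<-≤-trans (nthOfParity-gap (par u) i<j) (nthOfParity≤f _))

    f<n : ∀ {i} → i < k → f i < n
    -- Even after the shift, the terms of index below `k` stay below the term of index `k`, which is
    -- at most `2k + 1`.
    f<n i<k = <-≤-trans (≤-<-trans (f≤1+nthOfParity _) (nthOfParity-gap (par u) i<k))
      (≤-trans (nthOfParity≤ (par u) k) (≤-trans (≤-reflexive (cong (_+ 1) (*-comm k 2))) 2k+1≤n))

    u↝f : ∀ i {w} → toℕ w ≡ f i → u ↝ w
    u↝f i w≡ with nthOfParity (par u) i <? toℕ u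
    ... | yes nth<u = same (trans (sym (parity-nthOfParity (par u) i)) (cong parity (sym w≡)))
                           (subst (_< toℕ u) (sym w≡) nth<u)
    ... | no  nth≮u = other
      (λ eq → parity-suc (nthOfParity (par u) i)
        (trans (parity-nthOfParity (par u) i) (trans eq (cong parity w≡))))
      -- The shift makes the inequality strict, so the term equal to `toℕ u` also yields a vertex
      -- after `u`.
      (subst (toℕ u <_) (sym w≡) (s≤s (≮⇒≥ nth≮u)))

  module _ (S : Subset n) (∣S∣<k : ∣ S ∣ < k) where

    _⟶*_ : Fin n → Fin n → Set
    _⟶*_ = Star (ArcAvoiding D S)

    next : ∀ u → ∃ λ w → w ∉ S × u ↝ w
    next u with increasing-escapes S ∣S∣<k f f<n f-mono where open OutNeighbours u
    ... | i , w , _ , w≡ , w∉S = w , w∉S , OutNeighbours.u↝f u i w≡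

    step : ∀ {u v} → u ∉ S → v ∉ S → u ↝ v → ArcAvoiding D S u v
    step u∉S v∉S u↝v = u∉S , v∉S , ↝⇒arc u↝v

    connected-≢ : ∀ {u v} → Acc _<_ (toℕ u) → u ∉ S → v ∉ S → par u ≢ par v → u ⟶* v
    connected-≢ {u} {v} (acc rec) u∉S v∉S u≢v with toℕ u <? toℕ v | next u
    ... | yes u<v | _ = step u∉S v∉S (other u≢v u<v) ◅ ε
    ... | no  _   | w , w∉S , u↝w@(same eq w<u) =
      step u∉S w∉S u↝w ◅ connected-≢ (rec w<u) w∉S v∉S (u≢v ∘ trans eq)
    ... | no  u≮v | w , w∉S , u↝w@(other u≢w u<w) =
      step u∉S w∉S u↝w ◅ step w∉S v∉S (same (≢-≢⇒≡ u≢w u≢v) (≤-<-trans (≮⇒≥ u≮v) u<w)) ◅ ε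

    -- Surviving out-neighbours are followed downwards until one has the other parity; from there
    -- `connected-≢` applies. That last step goes up, which is harmless because `connected-≢` starts
    -- its own descent.
    connected-≡ : ∀ {u v} → Acc _<_ (toℕ u) → u ∉ S → v ∉ S → par u ≡ par v → u ⟶* v
    connected-≡ {u} (acc rec) u∉S v∉S u≡v with next u
    ... | w , w∉S , u↝w@(same eq w<u) =
      step u∉S w∉S u↝w ◅ connected-≡ (rec w<u) w∉S v∉S (trans (sym eq) u≡v)
    ... | w , w∉S , u↝w@(other u≢w _) =
      step u∉S w∉S u↝w ◅ connected-≢ (<-wellFounded _) w∉S v∉S (λ w≡v → u≢w (trans u≡v (sym w≡v)))

    connected : StronglyConnectedWithout D S
    connected u v u∉S v∉S with par u ℙ.≟ par v
    ... | yes u≡v = connected-≡ (<-wellFounded _) u∉S v∉S u≡v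
    ... | no  u≢v = connected-≢ (<-wellFounded _) u∉S v∉S u≢v

  strong : IsStrong D k
  strong = ≤-trans (+-monoˡ-≤ 1 (m≤m+n k (k + 0))) 2k+1≤n , connected

-- Upper and lower bounds combined

Sinv-and-Sinv′ : (D : Digraph n) (Xs : Vec (Subset n) m) → IsStrong (invertAll D Xs) k →
                 (∀ {j} (Ys : Vec (Subset n) j) → IsArcStrong (invertAll D Ys) k → m ≤ j) →
                 (Sinv k [ D ]≡ m) × (Sinv′ k [ D ]≡ m)
Sinv-and-Sinv′ D Xs strong minimal =
    -- Being `k`-strong implies being `k`-arc-strong, so one strong construction and one lower bound
    -- for arc-strength settle both parameters.
    ((Xs , strong) , λ j (Ys , s) → minimal Ys (strong⇒arcStrong (invertAll D Ys) s))
  , ((Xs , strong⇒arcStrong (invertAll D Xs) strong) , λ j (Ys , s) → minimal Ys s)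

theorem5p9 : ∀ (n k : ℕ) → 1 ≤ n → 1 ≤ k → 2 * k + 1 ≤ n →
    (n < 3 * k → (Sinv k [ TT n ]≡ 2) × (Sinv′ k [ TT n ]≡ 2)) ×
    (3 * k ≤ n → (Sinv k [ TT n ]≡ 1) × (Sinv′ k [ TT n ]≡ 1))
theorem5p9 n k _ 1≤k 2k+1≤n =
    (λ n<3k → Sinv-and-Sinv′ (TT n) (Class 0ℙ ∷ Class 1ℙ ∷ []) (Alternating.strong n k 2k+1≤n) (two n<3k))
  , (λ 3k≤n → Sinv-and-Sinv′ (TT n) (ThreeBlocks.X n k 3k≤n ∷ []) (ThreeBlocks.strong n k 3k≤n 1≤k) one)
  where
  open Alternating n k 2k+1≤n using (Class)

  2k≤n : 2 * k ≤ n
  2k≤n = m+n≤o⇒m≤o (2 * k) 2k+1≤n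

  2≤n : 2 ≤ n
  2≤n = ≤-trans (*-monoʳ-≤ 2 1≤k) 2k≤n

  one : ∀ {j} (Ys : Vec (Subset n) j) → IsArcStrong (invertAll (TT n) Ys) k → 1 ≤ j
  one []       s = contradiction s (TT-notArcStrong 2≤n 1≤k)
  one (Y ∷ Ys) _ = s≤s z≤n

  -- The order is generalised so that matching on `2 ≤ n` can expose the two successors expected by
  -- `invert-TT-bound`.
  bound : ∀ {n} X → 2 ≤ n → 2 * k ≤ n → IsArcStrong (invert (TT n) X) k → 3 * k ≤ n
  bound X (s≤s (s≤s _)) 2k≤n s = invert-TT-bound X s 1≤k 2k≤n

  two : n < 3 * k → ∀ {j} (Ys : Vec (Subset n) j) → IsArcStrong (invertAll (TT n) Ys) k → 2 ≤ j
  two _    []            s = contradiction s (TT-notArcStrong 2≤n 1≤k)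
  two n<3k (Y ∷ [])      s = contradiction (bound Y 2≤n 2k≤n s) (<⇒≱ n<3k)
  two _    (_ ∷ _ ∷ _)   _ = s≤s (s≤s z≤n)
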